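{- Let $\mathcal{U}$ be a non-principal ultrafilter on $\omega$. Then, for any uncountable cardinal $\kappa$, $[\kappa]^{<\omega}\leq_T\mathcal{U}$ if and only if $\tau_\kappa^\diamond\leq_K\mathcal{U}^*$.
   Context: For directed partial orders $\mathbb{P},\mathbb{Q}$, $\mathbb{Q}\leq_T\mathbb{P}$ means there is a map $P\to Q$ sending cofinal subsets of $\mathbb{P}$ to cofinal subsets of $\mathbb{Q}$. $\mathcal{U}$ is ordered by $\supseteq$ and $[\kappa]^{<\omega}$ by $\subseteq$. For ideals $\mathscr{I},\mathscr{J}$, $\mathscr{I}\leq_K\mathscr{J}$ means there is $f:\bigcup\mathscr{J}\to\bigcup\mathscr{I}$ with $f^{ -1}[A]\in\mathscr{J}$ for all $A\in\mathscr{I}$. $\mathcal{U}^*=\{\omega\setminus A:A\in\mathcal{U}\}$. For $A\in[\kappa]^\omega$ (a countably infinite subset of $\kappa$) and $f:A\to 2$, let $\chi(A,f)=\{x\in 2^\kappa:x\upharpoonright A=f\}$ and let $\chi_\omega(A,f)=[\chi(A,f)]^\omega$ be the family of countably infinite subsets of $\chi(A,f)$. $\tau_\kappa^\diamond$ is the ideal on $2^\kappa$ generated by $\bigcup_{A\in[\kappa]^\omega}\bigcup_{f\in 2^A}\chi_\omega(A,f)$. -}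

module Defs where

open import Level using (Level; 0ℓ; suc; _⊔_)
open import Data.Bool.Base using (Bool)
open import Data.List.Relation.Unary.All using (All)
open import Data.List.Relation.Unary.Any using (Any)
open import Data.List.Relation.Unary.Enumerates.Setoid using (IsEnumeration)
open import Data.Nat.Base using (ℕ)
open import Data.Product.Base using (Σ-syntax; ∃-syntax; _×_; _,_; proj₁)
open import Data.Sum.Base using (_⊎_)
open import Function.Bundles using (Func; Bijection; _↣_; _⇔_)
open import Relation.Binary.Bundles using (Setoid; Poset)
open import Relation.Binary.Definitions using (_Respects_)
import Relation.Binary.Construct.Flip.EqAndOrd as Flip
import Relation.Binary.Construct.On as On
open import Relation.Binary.PropositionalEquality using (_≡_; _≗_; setoid; _→-setoid_)
open import Relation.Nullary using (¬_)
open import Relation.Unary using (Pred; _∈_; _∉_; _⊆_; _≐_; _∩_; ∁; ∅; U)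
open import Relation.Unary.Relation.Binary.Subset using (⊆-poset)

private
  variable
    a b c i j p q r u : Level

open Func using (to)

-- All definitions are to be read classically.  Set₀ serves as the type of
-- propositions: under excluded middle at all levels every type is logically
-- equivalent to one in Set₀, so 𝒫 X is the full power set of X whatever the
-- universe of X.  Equality of subsets is _≐_.

𝒫 : Set a → Set (a ⊔ suc 0ℓ)
𝒫 X = Pred X 0ℓ

Family : Set a → (i : Level) → Set (a ⊔ suc 0ℓ ⊔ suc i)
Family X i = Pred (𝒫 X) i

infix 4 _∈≐_

-- Membership in a family up to extensional equality, which also allows the
-- subset to be given by a predicate in a larger universe.
_∈≐_ : {X : Set a} → Pred X p → Family X i → Set (a ⊔ suc 0ℓ ⊔ p ⊔ i)
A ∈≐ 𝓘 = ∃[ B ] B ∈ 𝓘 × B ≐ A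

⋃₀ : {X : Set a} → Family X i → Pred X (a ⊔ suc 0ℓ ⊔ i)
⋃₀ 𝓘 x = ∃[ A ] A ∈ 𝓘 × x ∈ A

infixl 6 _↾_

-- A subset as a setoid in its own right; membership proofs are irrelevant.
_↾_ : (S : Setoid a b) → Pred (Setoid.Carrier S) p → Setoid (a ⊔ p) b
S ↾ A = On.setoid S (proj₁ {B = _∈ A})

Finite : {X : Set a} → Pred X p → Set (a ⊔ p)
Finite {X = X} A = ∃[ xs ] IsEnumeration (setoid X ↾ A) xs

CountablyInfinite : (S : Setoid a b) → Pred (Setoid.Carrier S) p → Set (a ⊔ b ⊔ p)
CountablyInfinite S A = Bijection (setoid ℕ) (S ↾ A)

Uncountable : Set a → Set a
Uncountable X = ¬ (X ↣ ℕ)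

Cofinal : (P : Poset a b c) → Pred (Poset.Carrier P) p → Set (a ⊔ c ⊔ p)
Cofinal P X = ∀ x → ∃[ y ] y ∈ X × x ≤ y
  where open Poset P

image : (S : Setoid a b) (T : Setoid c r) → Func S T →
        Pred (Setoid.Carrier S) p → Pred (Setoid.Carrier T) (a ⊔ r ⊔ p)
image S T f X y = ∃[ x ] x ∈ X × Setoid._≈_ T (to f x) y

infix 4 _≤T_

_≤T_ : Poset a b c → Poset p q r → Set (a ⊔ b ⊔ c ⊔ suc 0ℓ ⊔ p ⊔ q ⊔ r)
Q ≤T P = Σ[ f ∈ Func P.Eq.setoid Q.Eq.setoid ]
  ((X : 𝒫 P.Carrier) → Cofinal P X → Cofinal Q (image P.Eq.setoid Q.Eq.setoid f X))
  where
  module P = Poset P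
  module Q = Poset Q

⟨_,⊇⟩ : Family ℕ u → Poset (suc 0ℓ ⊔ u) 0ℓ 0ℓ
⟨ 𝒰 ,⊇⟩ = On.poset (Flip.poset (⊆-poset ℕ 0ℓ)) (proj₁ {B = _∈ 𝒰})

[_]^<ω : (X : Set a) → Poset (a ⊔ suc 0ℓ) a a
[ X ]^<ω = On.poset (⊆-poset X 0ℓ) (proj₁ {B = Finite})

record IsUltrafilter {X : Set a} (𝒰 : Family X u) : Set (a ⊔ suc 0ℓ ⊔ u) where
  field
    whole     : U ∈ 𝒰
    proper    : ∅ ∉ 𝒰
    ∩-closed  : ∀ {A B} → A ∈ 𝒰 → B ∈ 𝒰 → A ∩ B ∈ 𝒰
    ⊆-closed  : ∀ {A B} → A ⊆ B → A ∈ 𝒰 → B ∈ 𝒰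
    ultra     : ∀ A → A ∈ 𝒰 ⊎ ∁ A ∈ 𝒰

Principal : {X : Set a} → Family X u → Set (a ⊔ suc 0ℓ ⊔ u)
Principal 𝒰 = ∃[ x ] ∀ A → A ∈ 𝒰 ⇔ x ∈ A

infix 8 _*

_* : {X : Set a} → Family X u → Family X (a ⊔ suc 0ℓ ⊔ u)
(𝒰 *) B = ∃[ A ] A ∈ 𝒰 × B ≐ ∁ A

-- The preimage f⁻¹[A] is a subset of ⋃ 𝓙, hence of the carrier of T.
KatetovReduction : (S : Setoid a b) → Family (Setoid.Carrier S) i →
                   (T : Setoid c r) → Family (Setoid.Carrier T) j →
                   Set (a ⊔ b ⊔ suc 0ℓ ⊔ i ⊔ c ⊔ r ⊔ j)
KatetovReduction S 𝓘 T 𝓙 = Σ[ f ∈ Func (T ↾ ⋃₀ 𝓙) (S ↾ ⋃₀ 𝓘) ]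
  (∀ A → A ∈ 𝓘 → (λ y → Σ[ m ∈ y ∈ ⋃₀ 𝓙 ] proj₁ (to f (y , m)) ∈ A) ∈≐ 𝓙)

syntax KatetovReduction S 𝓘 T 𝓙 = 𝓘 on S ≤K 𝓙 on T

-- The ideal consists of the subsets of finite unions of members of 𝓖.  The
-- points of S are its elements up to _≈_, so a genuine subset respects _≈_.
idealGeneratedBy : (S : Setoid a b) → Family (Setoid.Carrier S) i →
                   Family (Setoid.Carrier S) (a ⊔ b ⊔ suc 0ℓ ⊔ i)
idealGeneratedBy S 𝓖 A =
  A Respects _≈_ × (∃[ Gs ] All (_∈ 𝓖) Gs × (∀ {x} → x ∈ A → Any (x ∈_) Gs))
  where open Setoid S

-- Functions are compared pointwise, as function extensionality is not available.
2^_ : Set a → Setoid a a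
2^ κ = κ →-setoid Bool

module _ {κ : Set a} where

  χ : (A : 𝒫 κ) → Func (setoid κ ↾ A) (setoid Bool) → Pred (κ → Bool) a
  χ A f x = ∀ α (m : α ∈ A) → x α ≡ to f (α , m)

  χω : (A : 𝒫 κ) → Func (setoid κ ↾ A) (setoid Bool) → Family (κ → Bool) a
  χω A f C = C Respects _≗_ × CountablyInfinite (2^ κ) C × C ⊆ χ A f

τ◇ : (κ : Set a) → Family (κ → Bool) (a ⊔ suc 0ℓ)
τ◇ κ = idealGeneratedBy (2^ κ)
  (λ C → ∃[ A ] CountablyInfinite (setoid κ) A × (∃[ f ] C ∈ χω A f))

{-# OPTIONS --safe #-}
module Submission where

-- Both sides say that 𝒰 has members T α (α ∈ κ) such that each B ∈ 𝒰 is contained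
-- in only finitely many of them.  A Tukey map g provides T α such that B ⊆ T α
-- forces α ∈ g B, and conversely g B = { α ∣ B ⊆ T α } is a Tukey map.  The Katětov
-- map is f n α = [ n ∈ T α ]; conversely T α = { n ∣ f n α = h α }, where h α is
-- the 𝒰-limit of f n α.  If B ⊆ T α for all α in an infinite set A, then f[B] is a
-- countable subset of χ(A, h), so that B is disjoint from a set in 𝒰.

open import Defs
open import Axiom.DoubleNegationElimination using (em⇒dne)
open import Axiom.ExcludedMiddle using (ExcludedMiddle)
open import Data.Bool.Base using (Bool; true; false; not; if_then_else_)
open import Data.Bool.Properties using (not-¬; ¬-not)
open import Data.Fin.Base using (Fin; toℕ; fromℕ<)
open import Data.Fin.Properties using (pigeonhole; toℕ-injective; toℕ-fromℕ<)
import Data.Fin.Properties as Fin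
open import Data.List.Base as List using (List; []; _∷_; lookup; length)
open import Data.List.Relation.Unary.All as All using (All; []; _∷_)
open import Data.List.Relation.Unary.Any using (Any; here; there; index)
open import Data.List.Relation.Unary.Any.Properties using (lookup-index)
open import Data.Maybe.Base using (Maybe; just; nothing)
open import Data.Maybe.Properties using (just-injective)
open import Data.Nat.Base using (ℕ; zero; suc; _≤_; _<_; z≤n; s≤s)
open import Data.Nat.Properties using (<-cmp; n<1+n; m<1+n⇒m<n∨m≡n; m<n⇒m<1+n; <-≤-trans; ≤-trans; ≤-refl; ≤-antisym; ≮⇒≥; <-≤-connex)
open import Data.Product.Base using (Σ; Σ-syntax; ∃; ∃-syntax; _×_; _,_; proj₁; proj₂)
open import Data.Sum.Base using (_⊎_; inj₁; inj₂; [_,_]′)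
open import Function.Base using (_∘_; const; id)
open import Function.Bundles using (Bijection; Func; _⇔_; mk⇔; mk↣)
open import Level using (Level)
open import Relation.Binary.Bundles using (Setoid; Poset)
open import Relation.Binary.Definitions using (tri<; tri≈; tri>; _Respects_)
open import Relation.Binary.PropositionalEquality using (_≡_; _≢_; _≗_; refl; sym; trans; cong; cong-app; subst; setoid)
open import Relation.Nullary using (¬_; yes; no; contradiction)
open import Relation.Nullary.Decidable using (True; toWitness; fromWitness; isYes)
open import Relation.Unary using (Pred; _∈_; _∉_; _⊆_; _∩_; ∁; U)

private
  variable
    a b k p u : Level

-- Injective sequences against finite covers.

module _ (S : Setoid a b) where

  private module S = Setoid S
  open S using (Carrier; _≈_)

  distinct⇒injective : (z : ℕ → Carrier) →
    (∀ {i j} → i < j → ¬ z i ≈ z j) → ∀ {i j} → z i ≈ z j → i ≡ j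
  distinct⇒injective z distinct {i} {j} zi≈zj with <-cmp i j
  ... | tri< i<j _ _ = contradiction zi≈zj (distinct i<j)
  ... | tri≈ _ i≡j _ = i≡j
  ... | tri> _ _ j<i = contradiction (S.sym zi≈zj) (distinct j<i)

  -- Pigeonhole: among `z 0`, ..., `z n` two terms would be matched with the same `l i`.
  no-finite-cover : (z : ℕ → Carrier) → (∀ {i j} → z i ≈ z j → i ≡ j) →
    ∀ n (l : Fin n → Carrier) → ¬ (∀ k → ∃[ i ] z k ≈ l i)
  no-finite-cover z z-inj n l covered
    with i , j , i<j , eq ← pigeonhole (n<1+n n) (λ k → proj₁ (covered (toℕ k)))
    = Fin.<⇒≢ i<j (toℕ-injective (z-inj (S.trans (proj₂ (covered (toℕ i)))
        (S.trans (S.reflexive (cong l eq)) (S.sym (proj₂ (covered (toℕ j))))))))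

Finite⇒¬sequence : {X : Set a} {P : Pred X p} → Finite P → (z : ℕ → X) →
  (∀ {i j} → z i ≡ z j → i ≡ j) → ¬ (∀ n → z n ∈ P)
Finite⇒¬sequence (xs , enum) z z-inj z∈P =
  no-finite-cover (setoid _) z z-inj (length xs) (proj₁ ∘ lookup xs)
    (λ k → let k∈xs = enum (z k , z∈P k) in index k∈xs , lookup-index k∈xs)

-- Combining sequences.

-- The arguments swap roles at every step, which puts `y` at the even positions and `z` at the odd
-- ones without a parity test.
interleave : {X : Set a} → (ℕ → X) → (ℕ → X) → ℕ → X
interleave y z zero    = y zero
interleave y z (suc n) = interleave z (y ∘ suc) n

module _ {X : Set a} where

  mutual
    interleave-left : ∀ (y z : ℕ → X) n → ∃[ m ] interleave y z m ≡ y n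
    interleave-left y z zero    = zero , refl
    interleave-left y z (suc n) =
      let m , eq = interleave-right z (y ∘ suc) n in suc m , eq

    interleave-right : ∀ (y z : ℕ → X) n → ∃[ m ] interleave y z m ≡ z n
    interleave-right y z n =
      let m , eq = interleave-left z (y ∘ suc) n in suc m , eq

  interleave-all : (P : Pred X p) (y z : ℕ → X) →
    (∀ n → P (y n)) → (∀ n → P (z n)) → ∀ n → P (interleave y z n)
  interleave-all P y z Py Pz zero    = Py zero
  interleave-all P y z Py Pz (suc n) = interleave-all P z (y ∘ suc) Pz (Py ∘ suc) n

  -- Values in `Maybe` allow partial sequences, including the nowhere defined `const nothing`.
  prepend : List X → (ℕ → Maybe X) → ℕ → Maybe X
  prepend []       s n       = s n
  prepend (x ∷ xs) s zero    = just x
  prepend (x ∷ xs) s (suc n) = prepend xs s n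

  prepend-right : ∀ xs s n → ∃[ m ] prepend xs s m ≡ s n
  prepend-right []       s n = n , refl
  prepend-right (x ∷ xs) s n =
    let m , eq = prepend-right xs s n in suc m , eq

prepend-left : {X : Set a} {Y : Set b} (f : Y → X) {x : X} {ys : List Y} (s : ℕ → Maybe X) →
  Any (λ y → x ≡ f y) ys → ∃[ m ] prepend (List.map f ys) s m ≡ just x
prepend-left f s (here refl) = zero , refl
prepend-left f s (there x∈ys) = let m , eq = prepend-left f s x∈ys in suc m , eq

-- Classical principles.

module Classical (em : ∀ {ℓ} → ExcludedMiddle ℓ) where

  dne : {P : Set p} → ¬ ¬ P → P
  dne = em⇒dne em

  -- Resizing to Set₀, where 𝒫 takes its values.
  ⌞_⌟ : Set p → Set
  ⌞ P ⌟ = True (em {P = P})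

  ⌞_⌟⁺ : {P : Set p} → P → ⌞ P ⌟
  ⌞ x ⌟⁺ = fromWitness x

  ⌞_⌟⁻ : {P : Set p} → ⌞ P ⌟ → P
  ⌞ x ⌟⁻ = toWitness x

  least : (P : Pred ℕ p) → ∃ P → ∃[ m ] P m × (∀ {i} → i < m → ¬ P i)
  least P (n , Pn) with search (suc n)
    where
    search : ∀ n → (∃[ m ] P m × (∀ {i} → i < m → ¬ P i)) ⊎ (∀ {i} → i < n → ¬ P i)
    search zero = inj₂ λ ()
    search (suc n) with search n | em {P = P n}
    ... | inj₁ found | _      = inj₁ found
    ... | inj₂ none  | yes Pn = inj₁ (n , Pn , none)
    ... | inj₂ none  | no ¬Pn = inj₂ λ i<1+n Pi →
      [ (λ i<n → none i<n Pi) , (λ { refl → ¬Pn Pi }) ]′ (m<1+n⇒m<n∨m≡n i<1+n)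
  ... | inj₁ found = found
  ... | inj₂ none  = contradiction Pn (none ≤-refl)

  -- Increasing enumeration of an unbounded set of natural numbers.

  module _ (D : Pred ℕ p) (unbounded : ∀ n → ∃[ d ] n ≤ d × d ∈ D) where

    private
      next : ∀ n → ∃[ m ] (n ≤ m × m ∈ D) × (∀ {i} → i < m → ¬ (n ≤ i × i ∈ D))
      next n = least (λ m → n ≤ m × m ∈ D) (unbounded n)

      bound : ℕ → ℕ
      bound zero    = zero
      bound (suc n) = suc (proj₁ (next (bound n)))

      enum : ℕ → ℕ
      enum n = proj₁ (next (bound n))

      bound≤enum : ∀ n → bound n ≤ enum n
      bound≤enum n = proj₁ (proj₁ (proj₂ (next (bound n))))

      enum∈D : ∀ n → enum n ∈ D
      enum∈D n = proj₂ (proj₁ (proj₂ (next (bound n))))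

      enum<bound : ∀ {i j} → i < j → enum i < bound j
      enum<bound {j = suc j} i<1+j with m<1+n⇒m<n∨m≡n i<1+j
      ... | inj₁ i<j  = m<n⇒m<1+n (<-≤-trans (enum<bound i<j) (bound≤enum j))
      ... | inj₂ refl = ≤-refl

      enum-mono-< : ∀ {i j} → i < j → enum i < enum j
      enum-mono-< {j = j} i<j = <-≤-trans (enum<bound i<j) (bound≤enum j)

      n≤bound : ∀ n → n ≤ bound n
      n≤bound zero    = z≤n
      n≤bound (suc n) = s≤s (≤-trans (n≤bound n) (bound≤enum n))

      enum-surjective : ∀ {d} → d ∈ D → ∃[ n ] enum n ≡ d
      -- The search descends from `d < bound (suc d)` to an `n` with `bound n ≤ d ≤ enum n`; there
      -- the minimality of `enum n` forces equality.
      enum-surjective {d} d∈D = below (suc d) (n≤bound (suc d))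
        where
        below : ∀ n → d < bound n → ∃[ n ] enum n ≡ d
        below (suc n) (s≤s d≤enum) with <-≤-connex d (bound n)
        ... | inj₁ d<bound = below n d<bound
        ... | inj₂ bound≤d =
          n , ≤-antisym (≮⇒≥ λ d<enum → proj₂ (proj₂ (next (bound n))) d<enum (bound≤d , d∈D)) d≤enum

    -- Each term is the least element of `D` beyond the previous one, so no element is skipped.
    increasing-enumeration : Σ[ e ∈ (ℕ → ℕ) ] (∀ {i j} → i < j → e i < e j) ×
      (∀ n → e n ∈ D) × (∀ {d} → d ∈ D → ∃[ n ] e n ≡ d)
    increasing-enumeration = enum , enum-mono-< , enum∈D , enum-surjective

  -- Ranges of sequences as countably infinite sets.

  module _ (S : Setoid a b) where

    private module S = Setoid S
    open S using (Carrier; _≈_)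

    range : (ℕ → Carrier) → 𝒫 Carrier
    range s x = ⌞ (∃[ n ] x ≈ s n) ⌟

    ∈-range⁺ : ∀ (s : ℕ → Carrier) n → s n ∈ range s
    ∈-range⁺ s n = fromWitness (n , S.refl)

    ∈-range⁻ : ∀ (s : ℕ → Carrier) {x} → x ∈ range s → ∃[ n ] x ≈ s n
    ∈-range⁻ s = toWitness

    module _ (s z : ℕ → Carrier) (z-inj : ∀ {i j} → z i ≈ z j → i ≡ j)
             (z∈s : ∀ k → ∃[ m ] s m ≈ z k) where

      private
        Outside : ℕ → Pred ℕ _
        Outside n m = ∀ {i} → i < n → ¬ s m ≈ s i

        New : Pred ℕ _
        New n = Outside n n

        -- Otherwise the first `n` values of `s` would cover the injective sequence `z`.
        outside : ∀ n → ∃ (Outside n)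
        outside n = dne λ none → no-finite-cover S z z-inj n (s ∘ toℕ) λ k →
          let m , sm≈zk = z∈s k in dne λ uncovered → none
            (m , λ {i} i<n sm≈si → uncovered (fromℕ< i<n ,
              S.trans (S.sym sm≈zk) (S.trans sm≈si
                (S.reflexive (cong s (sym (toℕ-fromℕ< i<n)))))))

        unbounded : ∀ n → ∃[ d ] n ≤ d × d ∈ New
        -- The least `m` whose value lies outside the first `n` values is a first occurrence: an
        -- earlier index with the same value would lie outside as well.
        unbounded n with m , out , first ← least (Outside n) (outside n) =
          m , ≮⇒≥ (λ m<n → out m<n S.refl) ,
          λ {i} i<m sm≈si → first i<m (λ j<n si≈sj → out j<n (S.trans sm≈si si≈sj))

        first-occurrence : ∀ n → ∃[ m ] m ∈ New × s n ≈ s m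
        first-occurrence n with m , sn≈sm , first ← least (λ m → s n ≈ s m) (n , S.refl) =
          m , (λ i<m sm≈si → first i<m (S.trans sn≈sm sm≈si)) , sn≈sm

        enumeration⇒bijection : (e : ℕ → ℕ) → (∀ {i j} → i < j → e i < e j) →
          (∀ n → e n ∈ New) → (∀ {d} → d ∈ New → ∃[ n ] e n ≡ d) →
          CountablyInfinite S (range s)
        enumeration⇒bijection e e-mono e∈New e-onto = record
          { to = λ n → s (e n) , ∈-range⁺ s (e n)
          ; cong = λ { refl → S.refl }
          ; bijective =
              distinct⇒injective S (s ∘ e) (λ {i} {j} i<j → e∈New j (e-mono i<j) ∘ S.sym) ,
              surjective
          }
          where
          surjective : (y : Σ Carrier (range s)) → ∃[ j ] (∀ {i} → i ≡ j → s (e i) ≈ proj₁ y)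
          surjective (x , x∈s) =
            let n , x≈sn = ∈-range⁻ s x∈s
                m , m∈New , sn≈sm = first-occurrence n
                j , ej≡m = e-onto m∈New
            in j , λ { refl → S.sym (S.trans x≈sn (S.trans sn≈sm (S.reflexive (cong s (sym ej≡m))))) }

      -- Since `s` may repeat values, only the indices of first occurrences are enumerated; the
      -- sequence `z` inside the range makes them unbounded.
      range-countablyInfinite : CountablyInfinite S (range s)
      range-countablyInfinite =
        let e , e-mono , e∈New , e-onto = increasing-enumeration New unbounded
        in enumeration⇒bijection e e-mono e∈New e-onto

  -- Infinite and uncountable sets.

  module _ {X : Set a} {P : Pred X p} (infinite : ¬ Finite P) where

    -- A list without a fresh point would enumerate `P`.
    fresh : (xs : List (Σ X P)) → ∃[ x ] ¬ Any (λ y → proj₁ x ≡ proj₁ y) xs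
    fresh xs = dne λ none → infinite (xs , λ x → dne λ x∉xs → none (x , x∉xs))

    initial : ℕ → List (Σ X P)
    initial zero    = []
    initial (suc n) = proj₁ (fresh (initial n)) ∷ initial n

    private
      s : ℕ → Σ X P
      s n = proj₁ (fresh (initial n))

      s∈initial : ∀ {i j} → i < j → Any (λ y → proj₁ (s i) ≡ proj₁ y) (initial j)
      s∈initial {j = suc j} i<1+j with m<1+n⇒m<n∨m≡n i<1+j
      ... | inj₁ i<j  = there (s∈initial i<j)
      ... | inj₂ refl = here refl

    infinite⇒sequence : Σ[ e ∈ (ℕ → X) ] (∀ {i j} → e i ≡ e j → i ≡ j) × (∀ n → e n ∈ P)
    infinite⇒sequence = proj₁ ∘ s ,
      distinct⇒injective (setoid X) (proj₁ ∘ s) distinct ,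
      proj₂ ∘ s
      where
      distinct : ∀ {i j} → i < j → proj₁ (s i) ≢ proj₁ (s j)
      distinct {j = j} i<j eq = proj₂ (fresh (initial j))
        (subst (λ x → Any (λ y → x ≡ proj₁ y) (initial j)) eq (s∈initial i<j))

  Avoids : {X : Set a} → (ℕ → Maybe X) → Pred X a
  Avoids s x = ∀ n → s n ≢ just x

  -- Assigning to each element an index at which it occurs would inject `X` into ℕ.
  uncountable⇒¬surjection : {X : Set a} → Uncountable X → (s : ℕ → Maybe X) →
    ¬ (∀ x → ∃[ n ] s n ≡ just x)
  uncountable⇒¬surjection uncountable s onto = uncountable (mk↣ {to = proj₁ ∘ onto} λ {x} {y} eq →
    just-injective (trans (sym (proj₂ (onto x))) (trans (cong s eq) (proj₂ (onto y)))))

  -- If only finitely many elements were avoided, listing them before `s` would exhaust `X`.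
  uncountable⇒avoids-infinite : {X : Set a} → Uncountable X → (s : ℕ → Maybe X) →
    ¬ Finite (Avoids s)
  uncountable⇒avoids-infinite {X = X} uncountable s (xs , enum) =
    uncountable⇒¬surjection uncountable s′ onto
    where
    s′ : ℕ → Maybe X
    s′ = prepend (List.map proj₁ xs) s

    onto : ∀ x → ∃[ n ] s′ n ≡ just x
    onto x with em {P = x ∈ Avoids s}
    ... | yes x∉s = prepend-left proj₁ s (enum (x , x∉s))
    ... | no ¬x∉s =
      let n , sn≡x = dne (λ none → ¬x∉s λ n sn≡x → none (n , sn≡x))
          m , eq = prepend-right (List.map proj₁ xs) s n
      in m , trans eq sn≡x

  -- Points of the cube 2^κ and members of `τ◇`.

  module _ {κ : Set k} where

    flip : (κ → Bool) → κ → κ → Bool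
    flip x β α = if isYes (em {P = α ≡ β}) then not (x α) else x α

    flip-≡ : ∀ x β → flip x β β ≡ not (x β)
    flip-≡ x β with em {P = β ≡ β}
    ... | yes _  = refl
    ... | no β≢β = contradiction refl β≢β

    flip-≢ : ∀ x {α β} → α ≢ β → flip x β α ≡ x α
    flip-≢ x {α} {β} α≢β with em {P = α ≡ β}
    ... | yes α≡β = contradiction α≡β α≢β
    ... | no _    = refl

    -- For `β ≢ γ` the two points differ at coordinate `β`, which only the first flips.
    flip-injective : ∀ x {β γ} → flip x β ≗ flip x γ → β ≡ γ
    flip-injective x {β} eq = dne λ β≢γ →
      not-¬ refl (trans (sym (flip-≢ x β≢γ)) (trans (sym (eq β)) (flip-≡ x β)))

    -- The points y n may form a finite set; flipping y 0 at coordinates outside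
    -- the range of e pads them to a countably infinite subset of χ.
    τ◇-cover : Uncountable κ → (e : ℕ → κ) → (∀ {i j} → e i ≡ e j → i ≡ j) →
      (h : κ → Bool) (y : ℕ → κ → Bool) → (∀ n i → y n (e i) ≡ h (e i)) →
      ∃[ C ] C ∈ τ◇ κ × (∀ n → y n ∈ C)
    τ◇-cover uncountable e e-inj h y y≡h
      with d , d-inj , d∉e ← infinite⇒sequence (uncountable⇒avoids-infinite uncountable (just ∘ e))
      = C
      , (C-resp , C ∷ [] ,
          (A , range-countablyInfinite (setoid κ) e e e-inj (λ n → n , refl) ,
           record { to = h ∘ proj₁ ; cong = cong h } ,
           C-resp ,
           range-countablyInfinite (2^ κ) t z (d-inj ∘ flip-injective (y 0)) z∈t ,
           C⊆χ) ∷ [] ,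
         here)
      , λ n → let m , eq = interleave-left y z n in ⌞ m , cong-app (sym eq) ⌟⁺
      where
      A : 𝒫 κ
      A = range (setoid κ) e

      z t : ℕ → κ → Bool
      z = flip (y 0) ∘ d
      t = interleave y z

      C : 𝒫 (κ → Bool)
      C = range (2^ κ) t

      C-resp : C Respects _≗_
      C-resp x≗x′ x∈C = let m , x≗tm = ⌞ x∈C ⌟⁻ in
        ⌞ m , (λ α → trans (sym (x≗x′ α)) (x≗tm α)) ⌟⁺

      z∈t : ∀ n → ∃[ m ] t m ≗ z n
      z∈t n = let m , eq = interleave-right y z n in m , cong-app eq

      t≡h : ∀ m i → t m (e i) ≡ h (e i)
      t≡h = interleave-all (λ x → ∀ i → x (e i) ≡ h (e i)) y z y≡h
        (λ n i → trans (flip-≢ (y 0) (d∉e n i ∘ cong just)) (y≡h 0 i))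

      C⊆χ : C ⊆ χ A (record { to = h ∘ proj₁ ; cong = cong h })
      C⊆χ x∈C α α∈A with m , x≗tm ← ⌞ x∈C ⌟⁻ | i , refl ← ⌞ α∈A ⌟⁻ = trans (x≗tm α) (t≡h m i)

    -- Any function into the cube thus lands in the union of the ideal, as a Katětov map must. The
    -- constant sequence `x` is covered with `h = x`, along any injective sequence of coordinates.
    ∈-⋃τ◇ : Uncountable κ → ∀ x → x ∈ ⋃₀ (τ◇ κ)
    ∈-⋃τ◇ uncountable x
      with e , e-inj , _ ← infinite⇒sequence (uncountable⇒avoids-infinite uncountable (const nothing))
      = let C , C∈τ , x∈C = τ◇-cover uncountable e e-inj x (const x) (λ _ _ → refl)
        in C , C∈τ , x∈C 0

  -- Ultrafilters on ω and their dual ideals.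

  module _ {𝒰 : Family ℕ u} (ultrafilter : IsUltrafilter 𝒰) where

    open IsUltrafilter ultrafilter

    disjoint⇒⊥ : ∀ {A B} → A ∈ 𝒰 → B ∈ 𝒰 → ¬ (∀ {n} → n ∈ A → n ∉ B)
    disjoint⇒⊥ A∈𝒰 B∈𝒰 disjoint =
      proper (⊆-closed (λ (n∈A , n∈B) → contradiction n∈B (disjoint n∈A)) (∩-closed A∈𝒰 B∈𝒰))

    ∉⇒∁∈ : ∀ {A} → A ∉ 𝒰 → ∁ A ∈ 𝒰
    ∉⇒∁∈ {A} A∉𝒰 with ultra A
    ... | inj₁ A∈𝒰  = contradiction A∈𝒰 A∉𝒰
    ... | inj₂ ∁A∈𝒰 = ∁A∈𝒰

    inhabited : ∀ {A} → A ∈ 𝒰 → ∃ A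
    inhabited A∈𝒰 = dne λ empty → proper (⊆-closed (λ n∈A → contradiction (_ , n∈A) empty) A∈𝒰)

    -- Nonprincipality puts all singletons into the dual ideal, so a Katětov map out of it is
    -- defined on all of ω.
    ∈-⋃𝒰* : ¬ Principal 𝒰 → ∀ n → n ∈ ⋃₀ (𝒰 *)
    ∈-⋃𝒰* nonprincipal n = (_≡ n) , (∁ (_≡ n) , ∉⇒∁∈ singleton∉𝒰 , (λ z ¬z → ¬z z) , dne) , refl
      where
      singleton∉𝒰 : (_≡ n) ∉ 𝒰
      singleton∉𝒰 n∈𝒰 = nonprincipal (n , λ A → mk⇔
        (λ A∈𝒰 → dne λ n∉A → disjoint⇒⊥ n∈𝒰 A∈𝒰 λ { refl → n∉A })
        (λ n∈A → ⊆-closed (λ { refl → n∈A }) n∈𝒰))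

    -- Intersecting finitely many complements reduces a statement about preimages of members of a
    -- generated ideal to one about its generators.
    avoid-all : {X : Set a} (f : ℕ → X) {Gs : List (𝒫 X)} →
      All (λ G → (λ n → f n ∈ G) ∉ 𝒰) Gs → ∃[ D ] D ∈ 𝒰 × (∀ {n} → n ∈ D → ¬ Any (f n ∈_) Gs)
    avoid-all f [] = U , whole , λ _ ()
    avoid-all f (G∉𝒰 ∷ Gs∉𝒰) = let D , D∈𝒰 , avoids = avoid-all f Gs∉𝒰 in
      _ , ∩-closed (∉⇒∁∈ G∉𝒰) D∈𝒰 ,
      λ { (n∉G , n∈D) (here n∈G) → n∉G n∈G ; (n∉G , n∈D) (there n∈Gs) → avoids n∈D n∈Gs }

  module _ {𝒰 : Family ℕ u} (ultrafilter : IsUltrafilter 𝒰)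
           (nonprincipal : ¬ Principal 𝒰)
           {κ : Set k} (uncountable : Uncountable κ) where

    open IsUltrafilter ultrafilter

    singleton : (α : κ) → Poset.Carrier [ κ ]^<ω
    singleton α = (λ β → ⌞ β ≡ α ⌟) , ((α , ⌞ refl ⌟⁺) ∷ []) , λ (β , β∈) → here ⌞ β∈ ⌟⁻

    -- From a Tukey map to a Katětov reduction.

    module Forward (tukey : [ κ ]^<ω ≤T ⟨ 𝒰 ,⊇⟩) where

      g : ∀ B → B ∈ 𝒰 → 𝒫 κ
      g B B∈𝒰 = proj₁ (Func.to (proj₁ tukey) (B , B∈𝒰))

      g-finite : ∀ B B∈𝒰 → Finite (g B B∈𝒰)
      g-finite B B∈𝒰 = proj₂ (Func.to (proj₁ tukey) (B , B∈𝒰))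

      -- Otherwise the B with α ∉ g B are cofinal in 𝒰, while no member of their
      -- image under g lies above {α}.
      threshold : ∀ α → ∃[ B ] B ∈ 𝒰 × (∀ {B′} (B′∈𝒰 : B′ ∈ 𝒰) → B′ ⊆ B → α ∈ g B′ B′∈𝒰)
      threshold α = dne λ none →
        let _ , ((B , B∈𝒰) , α∉gB , gB⊆Y , Y⊆gB) , α∈Y = proj₂ tukey
              (λ (B , B∈𝒰) → α ∉ g B B∈𝒰)
              (λ (B , B∈𝒰) → dne λ none-below → none
                (B , B∈𝒰 , λ {B′} B′∈𝒰 B′⊆B → dne λ α∉gB′ →
                  none-below ((B′ , B′∈𝒰) , α∉gB′ , B′⊆B)))
              (singleton α)
        in α∉gB (Y⊆gB (α∈Y ⌞ refl ⌟⁺))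

      T : κ → 𝒫 ℕ
      T α = proj₁ (threshold α)

      f : ℕ → κ → Bool
      f n α = isYes (em {P = n ∈ T α})

      T⇒true : ∀ {n α} → n ∈ T α → f n α ≡ true
      T⇒true {n} {α} n∈T with em {P = n ∈ T α}
      ... | yes _  = refl
      ... | no n∉T = contradiction n∈T n∉T

      true⇒T : ∀ {n α} → f n α ≡ true → n ∈ T α
      true⇒T {n} {α} eq with em {P = n ∈ T α}
      true⇒T eq | yes n∈T = n∈T
      true⇒T () | no _

      -- If the preimage of `G` were in `𝒰`, it would lie inside `T α` for every `α` in `A`, and its
      -- finite image under `g` would contain the infinite set `A`.
      generator∉𝒰 : ∀ {A h G} → CountablyInfinite (setoid κ) A → G ∈ χω A h →
        (λ n → f n ∈ G) ∉ 𝒰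
      generator∉𝒰 {A} {h} {G} A-countable (_ , _ , G⊆χ) D∈𝒰 =
        Finite⇒¬sequence (g-finite _ D∈𝒰) (proj₁ ∘ to) injective
          (λ i → proj₂ (proj₂ (threshold _)) D∈𝒰 (D⊆T (to i)))
        where
        open Bijection A-countable

        D⊆T : ((α , _) : Σ κ A) → (λ n → f n ∈ G) ⊆ T α
        -- On the preimage the bit `f n α` is constantly `h α`. The value `true` is the inclusion
        -- sought; `false` would make the preimage and `T α` disjoint members of `𝒰`.
        D⊆T (α , α∈A) {n} n∈D with Func.to h (α , α∈A) in hα
        ... | true  = true⇒T (trans (G⊆χ n∈D α α∈A) hα)
        ... | false = contradiction (proj₁ (proj₂ (threshold α))) λ T∈𝒰 →
          disjoint⇒⊥ ultrafilter D∈𝒰 T∈𝒰 λ m∈D m∈T →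
            contradiction (trans (sym (T⇒true m∈T)) (trans (G⊆χ m∈D α α∈A) hα)) λ ()

      reduction : τ◇ κ on 2^ κ ≤K 𝒰 * on setoid ℕ
      reduction =
        record { to = λ (n , _) → f n , ∈-⋃τ◇ uncountable (f n) ; cong = λ { refl _ → refl } } ,
        λ C (_ , Gs , Gs∈τ , C⊆Gs) →
          let D , D∈𝒰 , avoids = avoid-all ultrafilter f
                (All.map
                  (λ { (A , A-countable , h , G∈χω) → generator∉𝒰 {h = h} A-countable G∈χω }) Gs∈τ)
              P = λ n → ⌞ (Σ[ m ∈ n ∈ ⋃₀ (𝒰 *) ] f n ∈ C) ⌟
          -- The preimage of `C` misses `D`, because `C` is covered by the generators that `f`
          -- avoids on `D`.
          in P , (∁ P , ⊆-closed (λ n∈D n∈P → avoids n∈D (C⊆Gs (proj₂ ⌞ n∈P ⌟⁻))) D∈𝒰 ,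
                  (λ z ¬z → ¬z z) , dne) ,
             ⌞_⌟⁻ , ⌞_⌟⁺

    -- From a Katětov reduction to a Tukey map.

    module Backward (reduction : τ◇ κ on 2^ κ ≤K 𝒰 * on setoid ℕ) where

      f : ℕ → κ → Bool
      f n = proj₁ (Func.to (proj₁ reduction) (n , ∈-⋃𝒰* ultrafilter nonprincipal n))

      limit : ∀ α → ∃[ b ] (λ n → f n α ≡ b) ∈ 𝒰
      limit α with ultra (λ n → f n α ≡ true)
      ... | inj₁ true∈𝒰  = true , true∈𝒰
      ... | inj₂ ¬true∈𝒰 = false , ⊆-closed ¬-not ¬true∈𝒰

      h : κ → Bool
      h α = proj₁ (limit α)

      T : κ → 𝒫 ℕ
      T α n = f n α ≡ h α

      g : 𝒫 ℕ → 𝒫 κ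
      g B α = B ⊆ T α

      g-finite : ∀ {B} → B ∈ 𝒰 → Finite (g B)
      g-finite {B} B∈𝒰 = dne λ infinite →
        let e , e-inj , e∈g = infinite⇒sequence infinite
            C , C∈τ , y∈C = τ◇-cover uncountable e e-inj h y (λ n i → e∈g i (pick∈B n))
            P , (A , A∈𝒰 , P⊆∁A , _) , _ , f⁻¹C⊆P = proj₂ reduction C C∈τ
        in disjoint⇒⊥ ultrafilter B∈𝒰 A∈𝒰 λ {n} n∈B →
             P⊆∁A (f⁻¹C⊆P (∈-⋃𝒰* ultrafilter nonprincipal n ,
               subst (λ m → f m ∈ C) (pick-≡ n∈B) (y∈C n)))
        where
        -- A retraction of ω onto `B`, which makes the points `f n` with `n` in `B` a sequence
        -- indexed by ℕ; indices outside `B` go to one fixed element of `B`.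
        pick : ℕ → ∃ B
        pick n with em {P = n ∈ B}
        ... | yes n∈B = n , n∈B
        ... | no _    = inhabited ultrafilter B∈𝒰

        pick∈B : ∀ n → proj₁ (pick n) ∈ B
        pick∈B = proj₂ ∘ pick

        pick-≡ : ∀ {n} → n ∈ B → proj₁ (pick n) ≡ n
        pick-≡ {n} n∈B with em {P = n ∈ B}
        ... | yes _  = refl
        ... | no n∉B = contradiction n∈B n∉B

        y : ℕ → κ → Bool
        y = f ∘ proj₁ ∘ pick

      -- Finite sets of coordinates are bounded in the Tukey sense: one member of `𝒰` lies below all
      -- the corresponding `T α`.
      ⋂T∈𝒰 : {F : 𝒫 κ} (xs : List (Σ κ F)) →
        ∃[ B ] B ∈ 𝒰 × (∀ {α} → Any (λ y → α ≡ proj₁ y) xs → B ⊆ T α)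
      ⋂T∈𝒰 [] = U , whole , λ ()
      ⋂T∈𝒰 ((α , _) ∷ xs) = let B , B∈𝒰 , B⊆T = ⋂T∈𝒰 xs in
        T α ∩ B , ∩-closed (proj₂ (limit α)) B∈𝒰 ,
        λ { (here refl) (n∈T , _) → n∈T ; (there α∈xs) (_ , n∈B) → B⊆T α∈xs n∈B }

      tukey : [ κ ]^<ω ≤T ⟨ 𝒰 ,⊇⟩
      tukey =
        record
          { to = λ (B , B∈𝒰) → g B , g-finite B∈𝒰
          ; cong = λ (B⊆B′ , B′⊆B) → (λ B⊆T n∈B′ → B⊆T (B′⊆B n∈B′)) , (λ B′⊆T n∈B → B′⊆T (B⊆B′ n∈B))
          } ,
        λ X X-cofinal (F , xs , enum) →
          -- Cofinality of `X` gives a member `B′` inside the intersection `B` of the `T α` with `α`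
          -- in `F`, so `g` of `B′` contains `F`.
          let B , B∈𝒰 , B⊆T = ⋂T∈𝒰 xs
              B′ , B′∈X , B′⊆B = X-cofinal (B , B∈𝒰)
          in (g (proj₁ B′) , g-finite (proj₂ B′)) , (B′ , B′∈X , id , id) , λ α∈F n∈B′ → B⊆T (enum (_ , α∈F)) (B′⊆B n∈B′)

theorem2p15 : (∀ {ℓ} → ExcludedMiddle ℓ) →
    ∀ {u} (𝒰 : Family ℕ u) → IsUltrafilter 𝒰 → ¬ Principal 𝒰 →
    ∀ {k} (κ : Set k) → Uncountable κ →
    ([ κ ]^<ω ≤T ⟨ 𝒰 ,⊇⟩) ⇔ (τ◇ κ on 2^ κ ≤K 𝒰 * on setoid ℕ)
theorem2p15 em 𝒰 ultrafilter nonprincipal κ uncountable =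
  mk⇔ (Forward.reduction ultrafilter nonprincipal uncountable)
      (Backward.tukey ultrafilter nonprincipal uncountable)
  where open Classical em
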